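{- For any (simple) graph $H$ with $k$ edges, $AR^*_s(H) \leq \binom{k+1}{2}$. Moreover, $AR^*_s(P_k) \leq \binom{k}{2}+1$ for every $k\geq 1$, $AR^*_s(C_k) \leq \binom{k}{2}$ for every $k\geq 3$, and $AR^*_s(M_k) = \binom{k+1}{2}$ for every $k\geq 1$.
   Context: $P_k$ is the path with $k$ edges, $C_k$ the cycle with $k$ edges, $M_k$ the matching with $k$ edges (all simple graphs). An edge-coloring of a graph (possibly with parallel edges) is proper if any two distinct edges sharing an endpoint (in particular parallel edges) receive distinct colors. An edge-colored graph is rainbow if all its edges have distinct colors. A copy of $H$ is a (not necessarily induced) subgraph isomorphic to $H$. $AR^*_s(H)$ is the smallest number of edges in a not necessarily simple finite graph $G$ (parallel edges are allowed) such that every proper edge-coloring of $G$ contains a rainbow copy of $H$. -}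

module Defs where

open import Data.Nat using (ℕ; zero; suc; _+_; _≤_; z≤n; s≤s)
open import Data.Nat.Properties using (m≢1+n+m)
open import Data.Fin using (Fin; zero; suc; toℕ; fromℕ; inject₁; _↑ˡ_; _↑ʳ_; splitAt)
open import Data.Fin.Properties
  using (toℕ-inject₁; inject₁-injective; suc-injective; ↑ˡ-injective; splitAt-↑ˡ; splitAt-↑ʳ)
open import Data.Fin.Subset using (Subset; _∈_)
open import Data.Product using (Σ; ∃; _×_; _,_)
open import Data.Sum using (_⊎_; inj₁; inj₂)
open import Data.Empty using (⊥; ⊥-elim)
open import Function.Definitions using (Injective)
open import Relation.Binary.PropositionalEquality
  using (_≡_; _≢_; refl; sym; trans; cong)

-- A finite loopless multigraph with m edges.  The edges are undirected: which
-- endpoint is called the source is immaterial, see Joins.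

record Multigraph (m : ℕ) : Set where
  field
    order    : ℕ
    src tgt  : Fin m → Fin order
    loopless : ∀ e → src e ≢ tgt e

  Vertex Edge : Set
  Vertex = Fin order
  Edge   = Fin m

  Joins : Edge → Vertex → Vertex → Set
  Joins e u v = (src e ≡ u × tgt e ≡ v) ⊎ (src e ≡ v × tgt e ≡ u)

  _isEndpointOf_ : Vertex → Edge → Set
  v isEndpointOf e = (v ≡ src e) ⊎ (v ≡ tgt e)

record SimpleGraph (k : ℕ) : Set where
  field
    multigraph : Multigraph k
  open Multigraph multigraph public
  field
    noParallel : ∀ {e f u v} → Joins e u v → Joins f u v → e ≡ f

-- Since edge sets are finite, ℕ provides enough colors.

Coloring : ∀ {m} → Multigraph m → Set
Coloring G = Multigraph.Edge G → ℕ

Proper : ∀ {m} (G : Multigraph m) → Coloring G → Set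
Proper G c = ∀ {e f v} → e ≢ f → v isEndpointOf e → v isEndpointOf f → c e ≢ c f
  where open Multigraph G

record Subgraph {m} (G : Multigraph m) : Set where
  open Multigraph G
  field
    vertices : Subset order
    edges    : Subset m
    closed   : ∀ {e v} → e ∈ edges → v isEndpointOf e → v ∈ vertices

Rainbow : ∀ {m} {G : Multigraph m} → Coloring G → Subgraph G → Set
Rainbow c S = ∀ {e f} → e ∈ edges → f ∈ edges → c e ≡ c f → e ≡ f
  where open Subgraph S

-- An isomorphism from H to the subgraph S of G: bijections from the vertices and
-- edges of H onto those of S, carrying the two ends of each edge to the two ends
-- of its image.

record Iso {k m} (H : SimpleGraph k) {G : Multigraph m} (S : Subgraph G) : Set where
  private
    module H = SimpleGraph H
    module G = Multigraph G
  open Subgraph S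
  field
    onVertices            : H.Vertex → G.Vertex
    onEdges               : H.Edge → G.Edge
    onVertices-∈          : ∀ u → onVertices u ∈ vertices
    onEdges-∈             : ∀ e → onEdges e ∈ edges
    onVertices-injective  : Injective _≡_ _≡_ onVertices
    onEdges-injective     : Injective _≡_ _≡_ onEdges
    onVertices-surjective : ∀ {v} → v ∈ vertices → ∃ λ u → onVertices u ≡ v
    onEdges-surjective    : ∀ {f} → f ∈ edges → ∃ λ e → onEdges e ≡ f
    preservesEnds         : ∀ e → G.Joins (onEdges e) (onVertices (H.src e)) (onVertices (H.tgt e))

HasRainbowCopy : ∀ {k m} → SimpleGraph k → (G : Multigraph m) → Coloring G → Set
HasRainbowCopy H G c = Σ (Subgraph G) λ S → Iso H S × Rainbow c S

Forces : ∀ {k m} → Multigraph m → SimpleGraph k → Set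
Forces G H = (c : Coloring G) → Proper G c → HasRainbowCopy H G c

ForcedWith : ∀ {k} → SimpleGraph k → ℕ → Set
ForcedWith H m = Σ (Multigraph m) λ G → Forces G H

AR*ₛ[_]≡_ : ∀ {k} → SimpleGraph k → ℕ → Set
AR*ₛ[ H ]≡ m = ForcedWith H m × (∀ m′ → ForcedWith H m′ → m ≤ m′)

-- The minimum itself is required to exist: constructively this says more than
-- ForcedWith H m for some m ≤ N.
AR*ₛ[_]≤_ : ∀ {k} → SimpleGraph k → ℕ → Set
AR*ₛ[ H ]≤ N = ∃ λ m → (AR*ₛ[ H ]≡ m) × m ≤ N

private
  inject₁≢suc : ∀ {n} (i : Fin n) → inject₁ i ≢ suc i
  inject₁≢suc zero    ()
  inject₁≢suc (suc i) eq = inject₁≢suc i (suc-injective eq)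

  noSwap : ∀ {n} (i j : Fin n) → inject₁ i ≡ suc j → inject₁ j ≡ suc i → ⊥
  noSwap i j p q = m≢1+n+m (toℕ i) {1}
    (trans (trans (sym (toℕ-inject₁ i)) (cong toℕ p))
           (cong suc (trans (sym (toℕ-inject₁ j)) (cong toℕ q))))

  ↑ˡ≢↑ʳ : ∀ {k} (i j : Fin k) → i ↑ˡ k ≢ k ↑ʳ j
  ↑ˡ≢↑ʳ {k} i j eq
    with () ← trans (sym (splitAt-↑ˡ k i k)) (trans (cong (splitAt k) eq) (splitAt-↑ʳ k k j))

  module _ {m} (G : Multigraph m) where
    open Multigraph G
    sameEnds : ∀ {e f u v} → Joins e u v → Joins f u v →
               (src e ≡ src f × tgt e ≡ tgt f) ⊎ (src e ≡ tgt f × tgt e ≡ src f)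
    sameEnds (inj₁ (a , b)) (inj₁ (c , d)) = inj₁ (trans a (sym c) , trans b (sym d))
    sameEnds (inj₁ (a , b)) (inj₂ (c , d)) = inj₂ (trans a (sym d) , trans b (sym c))
    sameEnds (inj₂ (a , b)) (inj₁ (c , d)) = inj₂ (trans a (sym d) , trans b (sym c))
    sameEnds (inj₂ (a , b)) (inj₂ (c , d)) = inj₁ (trans a (sym c) , trans b (sym d))

-- Vertices 0, …, k; edge i joins i and i + 1.

path : ∀ k → SimpleGraph k
path k = record { multigraph = P ; noParallel = λ x y → unique (sameEnds P x y) }
  where
  P : Multigraph k
  P = record { order = suc k ; src = inject₁ ; tgt = suc ; loopless = inject₁≢suc }
  open Multigraph P
  unique : ∀ {e f} → (src e ≡ src f × tgt e ≡ tgt f) ⊎ (src e ≡ tgt f × tgt e ≡ src f) → e ≡ f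
  unique (inj₁ (p , _))         = inject₁-injective p
  unique {e} {f} (inj₂ (p , q)) = ⊥-elim (noSwap e f p (sym q))

-- Vertices 0, …, k - 1; edge i + 1 joins i and i + 1, and edge 0 joins k - 1 and 0.

cycle : ∀ k → 3 ≤ k → SimpleGraph k
cycle (suc (suc (suc n))) (s≤s (s≤s (s≤s z≤n))) =
  record { multigraph = C ; noParallel = λ {e} {f} x y → unique e f (sameEnds C x y) }
  where
  s t : Fin (3 + n) → Fin (3 + n)
  s zero    = fromℕ (2 + n)
  s (suc i) = inject₁ i
  t zero    = zero
  t (suc i) = suc i
  s≢t : ∀ e → s e ≢ t e
  s≢t zero    ()
  s≢t (suc i) = inject₁≢suc i
  C : Multigraph (3 + n)
  C = record { order = 3 + n ; src = s ; tgt = t ; loopless = s≢t }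
  unique : ∀ e f → (s e ≡ s f × t e ≡ t f) ⊎ (s e ≡ t f × t e ≡ s f) → e ≡ f
  unique zero    zero    _              = refl
  unique zero    (suc j) (inj₁ (_ , ()))
  unique (suc i) zero    (inj₁ (_ , ()))
  unique (suc i) (suc j) (inj₁ (_ , q)) = q
  unique zero    (suc zero)    (inj₂ (() , _))
  unique zero    (suc (suc j)) (inj₂ (_ , ()))
  unique (suc zero)    zero    (inj₂ (_ , ()))
  unique (suc (suc i)) zero    (inj₂ (() , _))
  unique (suc i) (suc j) (inj₂ (p , q)) = ⊥-elim (noSwap i j p (sym q))

-- Vertices 0, …, 2k - 1; edge i joins i and k + i.

matching : ∀ k → SimpleGraph k
matching k = record { multigraph = M ; noParallel = λ {e} {f} x y → unique e f (sameEnds M x y) }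
  where
  M : Multigraph k
  M = record { order = k + k ; src = _↑ˡ k ; tgt = k ↑ʳ_ ; loopless = λ e → ↑ˡ≢↑ʳ e e }
  unique : ∀ e f → (e ↑ˡ k ≡ f ↑ˡ k × k ↑ʳ e ≡ k ↑ʳ f) ⊎ (e ↑ˡ k ≡ k ↑ʳ f × k ↑ʳ e ≡ f ↑ˡ k) → e ≡ f
  unique e f (inj₁ (p , _)) = ↑ˡ-injective k e f p
  unique e f (inj₂ (p , _)) = ⊥-elim (↑ˡ≢↑ʳ e f p)

{-# OPTIONS --safe #-}
module Submission where

-- Upper bounds: give the i-th edge of H enough parallel copies that, choosing one
-- copy of each edge in turn, some color is still free.  Parallel edges have distinct
-- colors, so i copies (i = 1, …, k) always suffice; colors of earlier edges adjacent
-- to the i-th are avoided automatically, which saves copies for paths and cycles.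
--
-- Lower bound for matchings: coloring all edges differently yields a matching with
-- k + 1 edges.  Deleting it leaves a multigraph that forces a rainbow matching with k
-- edges, since the deleted matching can serve as one color class, which a rainbow
-- matching meets at most once.  Hence at least (k + 1) + k + … + 1 edges are needed.
--
-- Existence of the minimum: only the coincidences among edge ends and among colors
-- matter, so whether m edges can force H is decided by a finite search.

open import Data.Nat using (ℕ; _+_; _≤_)
open import Data.Nat.Combinatorics using (_C_)
open import Data.Product using (_×_)
open import Defs

open import Data.Bool using (if_then_else_)
open import Data.Empty using (⊥)
open import Data.Fin as Fin
  using (Fin; Fin′; zero; suc; toℕ; fromℕ; fromℕ<; inject; inject₁; splitAt; join; _↑ˡ_; _↑ʳ_; punchIn; finToFun; funToFin)
open import Data.Fin.Properties
  using ( _≟_; any?; all?; pigeonhole; toℕ-injective; toℕ-inject; toℕ-inject₁; toℕ-fromℕ; toℕ-fromℕ<; toℕ<n; toℕ≤pred[n]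
        ; splitAt-↑ˡ; splitAt-↑ʳ; ↑ˡ-injective; ↑ʳ-injective; splitAt-join; punchIn-injective; punchInᵢ≢i
        ; suc-injective; finToFun-funToFin; <-cmp; 0≢1+n)
open import Data.Fin.Subset using (Subset; _∈_; _-_; ∣_∣; ⊤; ⁅_⁆)
open import Data.Fin.Subset.Properties
  using (x∈p∧x≢y⇒x∈p-y; x∈p⇒∣p-x∣<∣p∣; ∈⊤; ∣⊤∣≡n; p─q⊆p; p─q─q≡p─q)
open import Data.Nat using (zero; suc; _<_; _∸_; _⊓_; z≤n; s≤s)
open import Data.Nat.Combinatorics using (nCk+nC[k+1]≡[n+1]C[k+1]; nC1≡n)
open import Data.Nat.Induction using (<-rec)
import Data.Nat.Properties as ℕ
open import Data.Product using (∃; ∃₂; Σ; _,_; proj₁; proj₂)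
open import Data.Sum using (_⊎_; inj₁; inj₂; [_,_]′)
import Data.Sum as Sum
open import Data.Vec using (tabulate)
open import Data.Vec.Properties using (lookup⇒[]=; []=⇒lookup; lookup∘tabulate)
open import Function using (_∘_; id; const)
open import Function.Definitions using (Injective)
open import Level using (0ℓ)
open import Relation.Binary using (tri<; tri≈; tri>; DecidableEquality; _Respects_)
open import Relation.Binary.PropositionalEquality
  using (_≡_; _≢_; _≗_; refl; sym; trans; cong; cong₂; subst; subst₂; module ≡-Reasoning)
open import Relation.Nullary using (Dec; yes; no; does; ¬_; ¬?; contradiction; recompute)
open import Relation.Nullary.Decidable using (map′; _×-dec_; _⊎-dec_; _→-dec_; dec-true; dec-false)
open import Relation.Unary using (Pred; Decidable)

open import Algebra.Properties.Monoid.Sum ℕ.+-0-monoid using (sum; sum-cong-≗; sum-init-last)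

private variable
  a b k m n : ℕ

-- Rainbow copies as embeddings

-- Injectivity of `c ∘ g` says both that `g` is injective and that its image is rainbow. Functions
-- replace the subsets, which suits a finite search.
RainbowEmbedding : SimpleGraph k → (G : Multigraph m) → Coloring G → Set
RainbowEmbedding H G c =
  Σ (H.Vertex → G.Vertex) λ φ → Injective _≡_ _≡_ φ ×
  Σ (H.Edge → G.Edge) λ g →
    (∀ e → G.Joins (g e) (φ (H.src e)) (φ (H.tgt e))) × Injective _≡_ _≡_ (c ∘ g)
  where
  module H = SimpleGraph H
  module G = Multigraph G

image : (Fin a → Fin b) → Subset b
image f = tabulate λ y → does (any? λ x → f x ≟ y)

∈-image⁺ : (f : Fin a → Fin b) → ∀ x → f x ∈ image f
∈-image⁺ f x = lookup⇒[]= (f x) (image f)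
  (trans (lookup∘tabulate _ (f x)) (dec-true (any? λ z → f z ≟ f x) (x , refl)))

∈-image⁻ : (f : Fin a → Fin b) → ∀ {y} → y ∈ image f → ∃ λ x → f x ≡ y
∈-image⁻ f {y} y∈ with any? (λ x → f x ≟ y) | trans (sym (lookup∘tabulate _ y)) ([]=⇒lookup y∈)
... | yes p | _ = p
... | no _  | ()

embedding⇒copy : (H : SimpleGraph k) (G : Multigraph m) (c : Coloring G) →
                 RainbowEmbedding H G c → HasRainbowCopy H G c
embedding⇒copy H G c (φ , φ-inj , g , joins , cg-inj) = S , iso , rainbow
  where
  module H = SimpleGraph H
  open Multigraph G

  endpoint-hit : ∀ {e v} → v isEndpointOf g e → ∃ λ u → φ u ≡ v
  endpoint-hit {e} v∈e with joins e | v∈e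
  ... | inj₁ (p , q) | inj₁ refl = H.src e , sym p
  ... | inj₁ (p , q) | inj₂ refl = H.tgt e , sym q
  ... | inj₂ (p , q) | inj₁ refl = H.tgt e , sym p
  ... | inj₂ (p , q) | inj₂ refl = H.src e , sym q

  S : Subgraph G
  S = record { vertices = image φ ; edges = image g ; closed = closed }
    where
    closed : ∀ {e v} → e ∈ image g → v isEndpointOf e → v ∈ image φ
    closed e∈ v∈e with ∈-image⁻ g e∈
    ... | x , refl with endpoint-hit v∈e
    ... | u , refl = ∈-image⁺ φ u

  iso : Iso H S
  iso = record
    { onVertices = φ ; onEdges = g
    ; onVertices-∈ = ∈-image⁺ φ ; onEdges-∈ = ∈-image⁺ g
    ; onVertices-injective = φ-inj ; onEdges-injective = cg-inj ∘ cong c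
    ; onVertices-surjective = ∈-image⁻ φ ; onEdges-surjective = ∈-image⁻ g
    ; preservesEnds = joins
    }

  rainbow : Rainbow c S
  rainbow e∈ f∈ ce≡cf with ∈-image⁻ g e∈ | ∈-image⁻ g f∈
  ... | x , refl | y , refl = cong g (cg-inj ce≡cf)

copy⇒embedding : (H : SimpleGraph k) (G : Multigraph m) (c : Coloring G) →
                 HasRainbowCopy H G c → RainbowEmbedding H G c
copy⇒embedding H G c (S , iso , rainbow) =
  onVertices , onVertices-injective , onEdges , preservesEnds ,
  λ p → onEdges-injective (rainbow (onEdges-∈ _) (onEdges-∈ _) p)
  where open Iso iso

-- Decidability of forcing

-- Functions between finite sets are numbered by `finToFun`; respect for `_≗_` stands in for
-- function extensionality.
anyFun? : {P : Pred (Fin a → Fin b) 0ℓ} → P Respects _≗_ → Decidable P → Dec (∃ P)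
anyFun? resp P? = map′ (λ (i , p) → finToFun i , p)
  (λ (f , p) → funToFin f , resp (λ x → sym (finToFun-funToFin f x)) p)
  (any? (P? ∘ finToFun))

allFun? : {P : Pred (Fin a → Fin b) 0ℓ} → P Respects _≗_ → Decidable P → Dec (∀ f → P f)
allFun? resp P? = map′ (λ h f → resp (finToFun-funToFin f) (h (funToFin f)))
  (λ h i → h (finToFun i))
  (all? (P? ∘ finToFun))

injective? : {A : Set} → DecidableEquality A → (f : Fin a → A) → Dec (Injective _≡_ _≡_ f)
injective? _≟A_ f = map′ (λ h {x} {y} → h x y) (λ h x y → h)
  (all? λ x → all? λ y → (f x ≟A f y) →-dec (x ≟ y))

injective-resp : {A : Set} {f g : Fin a → A} → f ≗ g → Injective _≡_ _≡_ f → Injective _≡_ _≡_ g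
injective-resp f≗g inj {x} {y} gx≡gy = inj (trans (f≗g x) (trans gx≡gy (sym (f≗g y))))

module _ (G : Multigraph m) where
  open Multigraph G

  joins? : ∀ e u v → Dec (Joins e u v)
  joins? e u v = ((src e ≟ u) ×-dec (tgt e ≟ v)) ⊎-dec ((src e ≟ v) ×-dec (tgt e ≟ u))

  endpoint? : ∀ v e → Dec (v isEndpointOf e)
  endpoint? v e = (v ≟ src e) ⊎-dec (v ≟ tgt e)

  proper? : (c : Coloring G) → Dec (Proper G c)
  proper? c = map′ (λ h {e} {f} {v} → h e f v) (λ h e f v → h)
    (all? λ e → all? λ f → all? λ v →
      ¬? (e ≟ f) →-dec (endpoint? v e →-dec (endpoint? v f →-dec ¬? (c e ℕ.≟ c f))))

  proper-reflects : {c d : Coloring G} → (∀ {e f} → c e ≡ c f → d e ≡ d f) → Proper G d → Proper G c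
  proper-reflects c⇒d proper e≢f v∈e v∈f = proper e≢f v∈e v∈f ∘ c⇒d

module _ (H : SimpleGraph k) (G : Multigraph m) where
  private
    module H = SimpleGraph H
    module G = Multigraph G

  embedding-reflects : {c d : Coloring G} → (∀ {e f} → c e ≡ c f → d e ≡ d f) →
                       RainbowEmbedding H G d → RainbowEmbedding H G c
  embedding-reflects c⇒d (φ , φ-inj , g , joins , inj) = φ , φ-inj , g , joins , inj ∘ c⇒d

  embedding? : (c : Coloring G) → Dec (RainbowEmbedding H G c)
  embedding? c = anyFun?
    (λ φ≗φ′ (inj , g , joins , cg-inj) → injective-resp φ≗φ′ inj , g ,
      (λ e → subst₂ (G.Joins (g e)) (φ≗φ′ _) (φ≗φ′ _) (joins e)) , cg-inj)
    λ φ → injective? _≟_ φ ×-dec anyFun?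
      (λ g≗g′ (joins , cg-inj) →
        (λ e → subst (λ x → G.Joins x _ _) (g≗g′ e) (joins e)) , injective-resp (cong c ∘ g≗g′) cg-inj)
      λ g → all? (λ e → joins? G (g e) _ _) ×-dec injective? ℕ._≟_ (c ∘ g)

  -- Only the partition into color classes matters, so m colors suffice.
  FinitelyForces : Set
  FinitelyForces = (c : Fin m → Fin m) → Proper G (toℕ ∘ c) → RainbowEmbedding H G (toℕ ∘ c)

  finitelyForces? : Dec FinitelyForces
  finitelyForces? = allFun?
    (λ c≗d forces proper-d →
      embedding-reflects (λ {e} {f} p → trans (cong toℕ (c≗d e)) (trans p (cong toℕ (sym (c≗d f)))))
        (forces (proper-reflects G
          (λ {e} {f} p → trans (cong toℕ (sym (c≗d e))) (trans p (cong toℕ (c≗d f)))) proper-d)))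
    λ c → proper? G (toℕ ∘ c) →-dec embedding? (toℕ ∘ c)

module _ {A : Set} (_≟A_ : DecidableEquality A) (f : Fin n → A) where

  -- The witness is recomputed by a search, so the preimage depends on y alone.
  preimage : ∀ y → .(∃ λ x → f x ≡ y) → ∃ λ x → f x ≡ y
  preimage y = recompute (any? λ x → f x ≟A y)

  representative : Fin n → Fin n
  representative x = proj₁ (preimage (f x) (x , refl))

  representative-cong : ∀ {x y} → f x ≡ f y → representative x ≡ representative y
  representative-cong {x} {y} = go (x , refl) (y , refl)
    where
    -- Once the two values are identified, irrelevance of the existence proofs makes both preimages
    -- definitionally equal.
    go : ∀ {u v} .(p : ∃ λ z → f z ≡ u) .(q : ∃ λ z → f z ≡ v) → u ≡ v →
         proj₁ (preimage u p) ≡ proj₁ (preimage v q)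
    go p q refl = refl

  representative-injective : ∀ {x y} → representative x ≡ representative y → f x ≡ f y
  representative-injective {x} {y} p =
    trans (sym (proj₂ (preimage (f x) (x , refl)))) (trans (cong f p) (proj₂ (preimage (f y) (y , refl))))

module _ (H : SimpleGraph k) (G : Multigraph m) where

  -- Replacing each color by a canonical edge of that color gives a coloring with the same color
  -- classes.
  finitelyForces⇒forces : FinitelyForces H G → Forces G H
  finitelyForces⇒forces forces c proper =
    embedding⇒copy H G c
      (embedding-reflects H G (λ {e} {f} p → cong toℕ (representative-cong ℕ._≟_ c {e} {f} p))
        (forces (representative ℕ._≟_ c)
          (proper-reflects G (λ {e} {f} p → representative-injective ℕ._≟_ c {e} {f} (toℕ-injective p)) proper)))

  forces⇒finitelyForces : Forces G H → FinitelyForces H G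
  forces⇒finitelyForces forces c proper = copy⇒embedding H G (toℕ ∘ c) (forces (toℕ ∘ c) proper)

-- Bounding the number of vertices

ends : (G : Multigraph m) → Fin m ⊎ Fin m → Multigraph.Vertex G
ends G = [ Multigraph.src G , Multigraph.tgt G ]′

module _ (H : SimpleGraph k) (G G′ : Multigraph m) where
  private
    module H  = SimpleGraph H
    module G  = Multigraph G
    module G′ = Multigraph G′

  -- Both multigraphs have the same edge set. By the first hypothesis a coloring proper on `G′` is
  -- proper on `G`; by the second an embedding into `G` moves to `G′` with the same edge map.
  finitelyForces-transfer :
    (∀ x y → ends G x ≡ ends G y → ends G′ x ≡ ends G′ y) →
    ((φ : H.Vertex → G.Vertex) → Injective _≡_ _≡_ φ →
      Σ (H.Vertex → G′.Vertex) λ φ′ → Injective _≡_ _≡_ φ′ ×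
        (∀ x u → ends G x ≡ φ u → ends G′ x ≡ φ′ u)) →
    FinitelyForces H G → FinitelyForces H G′
  finitelyForces-transfer merge lift forces c proper′ = transfer (forces c proper)
    where
    slot : ∀ {v e} → v G.isEndpointOf e →
           ∃ λ x → ends G x ≡ v × (ends G′ x G′.isEndpointOf e)
    slot {e = e} (inj₁ refl) = inj₁ e , refl , inj₁ refl
    slot {e = e} (inj₂ refl) = inj₂ e , refl , inj₂ refl

    proper : Proper G (toℕ ∘ c)
    proper {f = f} e≢f v∈e v∈f with slot v∈e | slot v∈f
    ... | x , refl , x∈e | y , y≡x , y∈f =
      proper′ e≢f x∈e (subst (G′._isEndpointOf f) (merge y x y≡x) y∈f)

    transfer : RainbowEmbedding H G (toℕ ∘ c) → RainbowEmbedding H G′ (toℕ ∘ c)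
    transfer (φ , φ-inj , g , joins , inj) with lift φ φ-inj
    ... | φ′ , φ′-inj , follows = φ′ , φ′-inj , g ,
      (λ e → Sum.map (λ (p , q) → follows (inj₁ (g e)) _ p , follows (inj₂ (g e)) _ q)
                     (λ (p , q) → follows (inj₁ (g e)) _ p , follows (inj₂ (g e)) _ q) (joins e)) ,
      inj

fromEnds : ∀ m (p : Fin (m + m) → Fin n) → (∀ e → p (e ↑ˡ m) ≢ p (m ↑ʳ e)) → Multigraph m
fromEnds {n = n} m p loopless = record
  { order = n ; src = λ e → p (e ↑ˡ m) ; tgt = λ e → p (m ↑ʳ e) ; loopless = loopless }

ends-fromEnds : ∀ m (p : Fin (m + m) → Fin n) (l : ∀ e → p (e ↑ˡ m) ≢ p (m ↑ʳ e)) →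
                ∀ x → ends (fromEnds m p l) x ≡ p (join m m x)
ends-fromEnds m p l (inj₁ _) = refl
ends-fromEnds m p l (inj₂ _) = refl

module _ (H : SimpleGraph k) where
  private module H = SimpleGraph H

  -- Listing all `m + m` edge ends in one function turns multigraphs on `n` vertices into a
  -- searchable finite function space.
  ForcedByEnds : ∀ m → (Fin (m + m) → Fin n) → Set
  ForcedByEnds m p = Σ (∀ e → p (e ↑ˡ m) ≢ p (m ↑ʳ e)) λ l → FinitelyForces H (fromEnds m p l)

  forcedByEnds? : ∀ m (p : Fin (m + m) → Fin n) → Dec (ForcedByEnds m p)
  forcedByEnds? m p with all? (λ e → ¬? (p (e ↑ˡ m) ≟ p (m ↑ʳ e)))
  ... | no ¬l = no (¬l ∘ proj₁)
  ... | yes l = map′ (l ,_) proj₂ (finitelyForces? H (fromEnds m p l))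

  forcedByEnds-resp : ∀ m → ForcedByEnds {n} m Respects _≗_
  forcedByEnds-resp m {x = p} {y = q} p≗q (l , forces) = l′ ,
    finitelyForces-transfer H (fromEnds m p l) (fromEnds m q l′)
      (λ x y eq → trans (sym (same x)) (trans eq (same y)))
      (λ φ φ-inj → φ , φ-inj , λ x u eq → trans (sym (same x)) eq)
      forces
    where
    l′ : ∀ e → q (e ↑ˡ m) ≢ q (m ↑ʳ e)
    l′ e eq = l e (trans (p≗q _) (trans eq (sym (p≗q _))))
    same : ∀ x → ends (fromEnds m p l) x ≡ ends (fromEnds m q l′) x
    same x = trans (ends-fromEnds m p l x) (trans (p≗q _) (sym (ends-fromEnds m q l′ x)))

  -- Each vertex meeting an edge is replaced by one of the 2m edge ends at it;
  -- the other vertices only serve as images of isolated vertices of H.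
  module Compress (G : Multigraph m) where
    private module G = Multigraph G

    end : Fin (m + m) → G.Vertex
    end = ends G ∘ splitAt m

    end-join : ∀ x → end (join m m x) ≡ ends G x
    end-join x = cong (ends G) (splitAt-join m m x)

    p : Fin (m + m) → Fin (m + m + H.order)
    p x = representative _≟_ end x ↑ˡ H.order

    p-cong : ∀ {x y} → end x ≡ end y → p x ≡ p y
    p-cong = cong (_↑ˡ H.order) ∘ representative-cong _≟_ end

    p-injective : ∀ {x y} → p x ≡ p y → end x ≡ end y
    p-injective = representative-injective _≟_ end ∘ ↑ˡ-injective H.order _ _

    loopless : ∀ e → p (e ↑ˡ m) ≢ p (m ↑ʳ e)
    loopless e eq = G.loopless e (trans (sym (end-join (inj₁ e))) (trans (p-injective eq) (end-join (inj₂ e))))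

    compressed : Multigraph m
    compressed = fromEnds m p loopless

    module _ (φ : H.Vertex → G.Vertex) (φ-inj : Injective _≡_ _≡_ φ) where

      -- The decision is an argument so that the lemmas on `place` can split on it.
      place : ∀ u → Dec (∃ λ x → end x ≡ φ u) → Fin (m + m + H.order)
      place u (yes (x , _)) = p x
      place u (no _)        = (m + m) ↑ʳ u

      place-follows : ∀ x u d → end x ≡ φ u → p x ≡ place u d
      place-follows x u (yes (y , y≡)) x≡ = p-cong (trans x≡ (sym y≡))
      place-follows x u (no ¬x)        x≡ = contradiction (x , x≡) ¬x

      ↑ˡ≢↑ʳ : ∀ (i : Fin a) (j : Fin b) → i ↑ˡ b ≢ a ↑ʳ j
      ↑ˡ≢↑ʳ {a} {b} i j eq
        with () ← trans (sym (splitAt-↑ˡ a i b)) (trans (cong (splitAt a) eq) (splitAt-↑ʳ a b j))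

      place-injective : ∀ u v d d′ → place u d ≡ place v d′ → u ≡ v
      place-injective u v (yes (x , x≡)) (yes (y , y≡)) eq =
        φ-inj (trans (sym x≡) (trans (p-injective eq) y≡))
      place-injective u v (yes _) (no _)  eq = contradiction eq (↑ˡ≢↑ʳ _ _)
      place-injective u v (no _)  (yes _) eq = contradiction (sym eq) (↑ˡ≢↑ʳ _ _)
      place-injective u v (no _)  (no _)  eq = ↑ʳ-injective (m + m) u v eq

    compressed-forces : FinitelyForces H G → FinitelyForces H compressed
    compressed-forces = finitelyForces-transfer H G compressed
      (λ x y eq → trans (ends-fromEnds m p loopless x)
        (trans (p-cong (trans (end-join x) (trans eq (sym (end-join y)))))
               (sym (ends-fromEnds m p loopless y))))
      (λ φ φ-inj → (λ u → place φ φ-inj u (hit? φ u)) , place-injective φ φ-inj _ _ (hit? φ _) (hit? φ _) ,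
        λ x u eq → trans (ends-fromEnds m p loopless x)
          (place-follows φ φ-inj (join m m x) u (hit? φ u) (trans (end-join x) eq)))
      where
      hit? : ∀ (φ : H.Vertex → G.Vertex) u → Dec (∃ λ x → end x ≡ φ u)
      hit? φ u = any? λ x → end x ≟ φ u

  -- By compression it suffices to search multigraphs on `m + m + H.order` vertices.
  forcedWith? : Decidable (ForcedWith H)
  forcedWith? m = map′
    (λ (p , l , forces) → fromEnds m p l , finitelyForces⇒forces H (fromEnds m p l) forces)
    (λ (G , forces) → let open Compress G in
      p , loopless , compressed-forces (forces⇒finitelyForces H G forces))
    (anyFun? {a = m + m} {b = m + m + H.order} (forcedByEnds-resp m) (forcedByEnds? m))

least : {P : Pred ℕ 0ℓ} → Decidable P → ∀ n → P n → ∃ λ m → (P m × (∀ m′ → P m′ → m ≤ m′)) × m ≤ n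
least {P} P? = <-rec _ λ n rec Pn → step n rec Pn (ℕ.anyUpTo? P? n)
  where
  Least : ℕ → Set
  Least n = P n → ∃ λ m → (P m × (∀ m′ → P m′ → m ≤ m′)) × m ≤ n
  step : ∀ n → (∀ {i} → i < n → Least i) → P n → Dec (∃ λ i → i < n × P i) →
         ∃ λ m → (P m × (∀ m′ → P m′ → m ≤ m′)) × m ≤ n
  step n rec Pn (yes (i , i<n , Pi)) with rec i<n Pi
  ... | m , min , m≤i = m , min , ℕ.≤-trans m≤i (ℕ.<⇒≤ i<n)
  step n rec Pn (no none) = n , (Pn , λ i Pi → ℕ.≮⇒≥ λ i<n → none (i , i<n , Pi)) , ℕ.≤-refl

forcedWith⇒AR≤ : (H : SimpleGraph k) → ForcedWith H n → AR*ₛ[ H ]≤ n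
forcedWith⇒AR≤ H = least (forcedWith? H) _

-- Upper bounds

-- Induction on `k`: after the first choice `a₀`, the later ones are made among elements paired with
-- a proof of compatibility with `a₀`.
greedy : {A : Fin k → Set} (R : ∀ {i j} → A i → A j → Set) →
         (∀ i (s : (j : Fin′ i) → A (inject j)) → Σ (A i) λ a → ∀ j → R (s j) a) →
         Σ (∀ i → A i) λ s → ∀ i (j : Fin′ i) → R (s (inject j)) (s i)
greedy {zero}          R extend = (λ ()) , λ ()
greedy {suc k} {A = A} R extend = s , compatible
  where
  a₀ : A zero
  a₀ = proj₁ (extend zero λ ())

  prepend : ∀ {i : Fin k} → ((j : Fin′ i) → Σ (A (suc (inject j))) (R a₀)) → (j : Fin′ (suc i)) → A (inject j)
  prepend s zero    = a₀
  prepend s (suc j) = proj₁ (s j)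

  rest : Σ (∀ i → Σ (A (suc i)) (R a₀)) λ s → ∀ i (j : Fin′ i) → R (proj₁ (s (inject j))) (proj₁ (s i))
  rest = greedy {A = λ i → Σ (A (suc i)) (R a₀)} (λ x y → R (proj₁ x) (proj₁ y)) λ i s →
    let (x , x-ok) = extend (suc i) (prepend s) in (x , x-ok zero) , λ j → x-ok (suc j)

  s : ∀ i → A i
  s zero    = a₀
  s (suc i) = proj₁ (proj₁ rest i)

  compatible : ∀ i (j : Fin′ i) → R (s (inject j)) (s i)
  compatible (suc i) zero    = proj₂ (proj₁ rest i)
  compatible (suc i) (suc j) = proj₂ rest i j

-- Multiplying edges

owner : (μ : Fin k → ℕ) → Fin (sum μ) → Fin k
owner {suc k} μ e = [ const zero , suc ∘ owner (μ ∘ suc) ]′ (splitAt (μ zero) e)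

-- Inclusion of the `i`-th summand, with `Fin (sum μ)` read as the disjoint union of the
-- `Fin (μ i)`; `owner` recovers the index.
slot : (μ : Fin k → ℕ) (i : Fin k) → Fin (μ i) → Fin (sum μ)
slot {suc k} μ zero    x = x ↑ˡ sum (μ ∘ suc)
slot {suc k} μ (suc i) x = μ zero ↑ʳ slot (μ ∘ suc) i x

owner-slot : (μ : Fin k → ℕ) (i : Fin k) (x : Fin (μ i)) → owner μ (slot μ i x) ≡ i
owner-slot {suc k} μ zero x rewrite splitAt-↑ˡ (μ zero) x (sum (μ ∘ suc)) = refl
owner-slot {suc k} μ (suc i) x rewrite splitAt-↑ʳ (μ zero) (sum (μ ∘ suc)) (slot (μ ∘ suc) i x) =
  cong suc (owner-slot (μ ∘ suc) i x)

slot-injective : (μ : Fin k → ℕ) (i : Fin k) → Injective _≡_ _≡_ (slot μ i)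
slot-injective {suc k} μ zero    = ↑ˡ-injective (sum (μ ∘ suc)) _ _
slot-injective {suc k} μ (suc i) = slot-injective (μ ∘ suc) i ∘ ↑ʳ-injective (μ zero) _ _

inject-onto : {i j : Fin n} → j Fin.< i → ∃ λ (j′ : Fin′ i) → inject j′ ≡ j
inject-onto j<i = fromℕ< j<i , toℕ-injective (trans (toℕ-inject (fromℕ< j<i)) (toℕ-fromℕ< j<i))

inject≢ : {i : Fin n} (j : Fin′ i) → inject j ≢ i
inject≢ {i = i} j eq = ℕ.<⇒≢ (toℕ<n j) (trans (sym (toℕ-inject j)) (cong toℕ eq))

blowUp : SimpleGraph k → (μ : Fin k → ℕ) → Multigraph (sum μ)
blowUp H μ = record
  { order = order ; src = src ∘ owner μ ; tgt = tgt ∘ owner μ ; loopless = loopless ∘ owner μ }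
  where open SimpleGraph H

Adjacent : SimpleGraph k → Fin k → Fin k → Set
Adjacent H e f = ∃ λ v → v isEndpointOf e × v isEndpointOf f
  where open SimpleGraph H

-- Properness already separates the color of an edge from those of its neighbours, so when
-- the edges are chosen in order, only the earlier non-neighbours of i, confined
-- to an interval of length w i, can forbid one of the w i + 1 parallel edges.
module _ (H : SimpleGraph k) (lo w : Fin k → ℕ)
  (window : ∀ i (j : Fin′ i) → Adjacent H (inject j) i ⊎ ∃ λ (r : Fin (w i)) → lo i + toℕ r ≡ toℕ j)
  where
  private
    module H = SimpleGraph H
    μ : Fin k → ℕ
    μ = suc ∘ w
    G : Multigraph (sum μ)
    G = blowUp H μ
    module G = Multigraph G

  blowUp-forces : Forces G H
  blowUp-forces c proper = embedding⇒copy H G c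
    (id , id , sel , (λ e → inj₁ (cong H.src (owner-slot μ e _) , cong H.tgt (owner-slot μ e _))) , inj)
    where
    endpoint-slot : ∀ {i v} x → v H.isEndpointOf i → v G.isEndpointOf slot μ i x
    endpoint-slot {i} {v} x = subst (v H.isEndpointOf_) (sym (owner-slot μ i x))

    Clash : ∀ {i} → ((j : Fin′ i) → Fin (μ (inject j))) → Fin (μ i) → Fin′ i → Set
    Clash {i} s x j = c (slot μ (inject j) (s j)) ≡ c (slot μ i x)

    -- Copies of adjacent edges are distinct edges sharing an endpoint, so properness excludes a
    -- clash; only the window remains.
    clash-rank : ∀ {i} s x → ∃ (Clash {i} s x) →
                 ∃₂ λ (r : Fin (w i)) j → lo i + toℕ r ≡ toℕ j × Clash s x j
    clash-rank {i} s x (j , clash) with window i j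
    ... | inj₂ (r , eq) = r , j , eq , clash
    ... | inj₁ (v , v∈j , v∈i) = contradiction clash
      (proper (λ eq → inject≢ j (trans (sym (owner-slot μ _ _)) (trans (cong (owner μ) eq) (owner-slot μ _ _))))
        (endpoint-slot (s j) v∈j) (endpoint-slot x v∈i))

    extend : ∀ i (s : (j : Fin′ i) → Fin (μ (inject j))) → Σ (Fin (μ i)) λ x → ∀ j → ¬ Clash s x j
    extend i s with any? (λ x → ¬? (any? λ j → c (slot μ (inject j) (s j)) ℕ.≟ c (slot μ i x)))
    ... | yes (x , free) = x , λ j clash → free (j , clash)
    -- If all `w i + 1` copies were blocked, two would be blocked by the same earlier edge and share
    -- its color, although they are parallel.
    ... | no  blocked    = contradiction (pigeonhole ℕ.≤-refl (proj₁ ∘ rank)) no-collision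
      where
      rank : ∀ x → ∃₂ λ (r : Fin (w i)) j → lo i + toℕ r ≡ toℕ j × Clash s x j
      rank x with any? (λ j → c (slot μ (inject j) (s j)) ℕ.≟ c (slot μ i x))
      ... | yes clash = clash-rank s x clash
      ... | no  free  = contradiction (x , free) blocked

      no-collision : ¬ (∃₂ λ x y → x Fin.< y × proj₁ (rank x) ≡ proj₁ (rank y))
      no-collision (x , y , x<y , eq) with rank x | rank y
      ... | r , j , r≡j , clash | r′ , j′ , r′≡j′ , clash′ =
        proper (λ p → ℕ.<⇒≢ x<y (cong toℕ (slot-injective μ i p)))
          (endpoint-slot x (inj₁ refl)) (endpoint-slot y (inj₁ refl))
          (trans (sym clash) (trans (cong (λ z → c (slot μ (inject z) (s z))) j≡j′) clash′))
        where
        j≡j′ : j ≡ j′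
        j≡j′ = toℕ-injective (trans (sym r≡j) (trans (cong (λ z → lo i + toℕ z) eq) r′≡j′))

    choice : Σ (∀ i → Fin (μ i)) λ s → ∀ i (j : Fin′ i) →
             c (slot μ (inject j) (s (inject j))) ≢ c (slot μ i (s i))
    choice = greedy {A = Fin ∘ μ} (λ {i} {j} x y → c (slot μ i x) ≢ c (slot μ j y)) extend

    sel : Fin k → Fin (sum μ)
    sel i = slot μ i (proj₁ choice i)

    distinct : ∀ {i j} → j Fin.< i → c (sel j) ≢ c (sel i)
    distinct {i} j<i with inject-onto j<i
    ... | j′ , refl = proj₂ choice i j′

    inj : Injective _≡_ _≡_ (c ∘ sel)
    inj {i} {j} eq with <-cmp i j
    ... | tri< i<j _ _ = contradiction eq (distinct i<j)
    ... | tri≈ _ i≡j _ = i≡j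
    ... | tri> _ _ j<i = contradiction (sym eq) (distinct j<i)

  blowUp-forced : ForcedWith H (sum (suc ∘ w))
  blowUp-forced = G , blowUp-forces

-- Edge counts for arbitrary graphs, paths and cycles

[1+n]C2≡n+nC2 : ∀ n → suc n C 2 ≡ n + n C 2
[1+n]C2≡n+nC2 n = trans (sym (nCk+nC[k+1]≡[n+1]C[k+1] n 1)) (cong (_+ n C 2) (nC1≡n n))

triangle : ∀ n → sum {n} (suc ∘ toℕ) ≡ suc n C 2
triangle zero    = refl
triangle (suc n) = begin
  sum {suc n} (suc ∘ toℕ)                       ≡⟨ sum-init-last {n} (suc ∘ toℕ) ⟩
  sum {n} (suc ∘ toℕ ∘ inject₁) + suc (toℕ (fromℕ n))
    ≡⟨ cong₂ _+_ (sum-cong-≗ {n} (cong suc ∘ toℕ-inject₁)) (cong suc (toℕ-fromℕ n)) ⟩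
  sum {n} (suc ∘ toℕ) + suc n                   ≡⟨ cong (_+ suc n) (triangle n) ⟩
  suc n C 2 + suc n                             ≡⟨ ℕ.+-comm (suc n C 2) (suc n) ⟩
  suc n + suc n C 2                             ≡⟨ [1+n]C2≡n+nC2 (suc n) ⟨
  suc (suc n) C 2                               ∎
  where open ≡-Reasoning

forced-triangle : (H : SimpleGraph k) → ForcedWith H (suc k C 2)
forced-triangle {k} H = subst (ForcedWith H) (triangle k)
  -- Every earlier edge is allowed to clash, so edge `i` gets `toℕ i + 1` copies.
  (blowUp-forced H (const 0) toℕ λ i j → inj₂ (j , refl))

-- The immediate predecessor of an edge is adjacent to it and leaves the window, saving one copy for
-- every edge but the first: `1 + (1 + … + n)` in total.
forced-path : ∀ n → ForcedWith (path (suc n)) (suc (suc n C 2))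
forced-path n = subst (ForcedWith (path (suc n))) (cong suc (triangle n))
  (blowUp-forced (path (suc n)) (const 0) w window)
  where
  w : Fin (suc n) → ℕ
  w zero    = 0
  w (suc i) = toℕ i
  window : ∀ i (j : Fin′ i) → Adjacent (path (suc n)) (inject j) i ⊎ ∃ λ (r : Fin (w i)) → toℕ r ≡ toℕ j
  window (suc i) j with ℕ.m≤n⇒m<n∨m≡n (toℕ≤pred[n] j)
  ... | inj₁ j<i = inj₂ (fromℕ< j<i , toℕ-fromℕ< j<i)
  ... | inj₂ j≡i = inj₁ (inject₁ (suc i) , inj₂ (cong suc (sym inject-j≡i)) , inj₁ refl)
    where
    inject-j≡i : inject {i = suc i} j ≡ inject₁ i
    inject-j≡i = toℕ-injective (trans (toℕ-inject {i = suc i} j) (trans j≡i (sym (toℕ-inject₁ i))))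

-- As for paths, with one more copy saved at the last edge. There `toℕ i` is `suc n`, so the window
-- starts at `1` and has length `n`; all other windows start at `0`.
forced-cycle : ∀ k (3≤k : 3 ≤ k) → ForcedWith (cycle k 3≤k) (k C 2)
forced-cycle (suc (suc (suc n))) (s≤s (s≤s (s≤s z≤n))) = subst (ForcedWith Cₖ) count
  (blowUp-forced Cₖ lo w window)
  where
  Cₖ : SimpleGraph (3 + n)
  Cₖ = cycle (3 + n) (s≤s (s≤s (s≤s z≤n)))

  -- The last edge has two earlier neighbours, edge 0 and its predecessor.
  lo w : Fin (3 + n) → ℕ
  lo zero    = 0
  lo (suc i) = toℕ i ∸ n
  w zero    = 0
  w (suc i) = toℕ i ⊓ n

  lo+w : ∀ i → lo (suc i) + w (suc i) ≡ toℕ i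
  lo+w i = begin
    (toℕ i ∸ n) + (toℕ i ⊓ n) ≡⟨ ℕ.+-comm (toℕ i ∸ n) _ ⟩
    (toℕ i ⊓ n) + (toℕ i ∸ n) ≡⟨ cong (_+ (toℕ i ∸ n)) (ℕ.⊓-comm (toℕ i) n) ⟩
    (n ⊓ toℕ i) + (toℕ i ∸ n) ≡⟨ ℕ.m⊓n+n∸m≡n n (toℕ i) ⟩
    toℕ i                     ∎
    where open ≡-Reasoning

  target : ∀ e → SimpleGraph.tgt Cₖ e ≡ e
  target zero    = refl
  target (suc _) = refl

  window : ∀ i (j : Fin′ i) → Adjacent Cₖ (inject j) i ⊎ ∃ λ (r : Fin (w i)) → lo i + toℕ r ≡ toℕ j
  window (suc i) j with ℕ.m≤n⇒m<n∨m≡n (toℕ≤pred[n] j) | lo (suc i) ℕ.≤? toℕ j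
  ... | inj₂ j≡i | _ = inj₁ (inject₁ i , inj₂ (sym (trans (target (inject j)) inject-j≡i)) , inj₁ refl)
    where
    inject-j≡i : inject {i = suc i} j ≡ inject₁ i
    inject-j≡i = toℕ-injective (trans (toℕ-inject {i = suc i} j) (trans j≡i (sym (toℕ-inject₁ i))))
  ... | inj₁ j<i | yes lo≤j = inj₂ (fromℕ< r<w , (begin
      lo (suc i) + toℕ (fromℕ< r<w)    ≡⟨ cong (lo (suc i) +_) (toℕ-fromℕ< r<w) ⟩
      lo (suc i) + (toℕ j ∸ lo (suc i)) ≡⟨ ℕ.m+[n∸m]≡n lo≤j ⟩
      toℕ j                            ∎))
    where
    open ≡-Reasoning
    r<w : toℕ j ∸ lo (suc i) < w (suc i)
    r<w = subst (toℕ j ∸ lo (suc i) <_)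
      (trans (cong (_∸ lo (suc i)) (sym (lo+w i))) (ℕ.m+n∸m≡n (lo (suc i)) (w (suc i))))
      (ℕ.∸-monoˡ-< j<i lo≤j)
  -- A positive lower end occurs only for the last edge, whose target is the source of edge `0`.
  window (suc i) zero | inj₁ _ | no lo≰0 =
    inj₁ (suc i , inj₁ (cong suc (toℕ-injective (trans i≡1+n (sym (toℕ-fromℕ (suc n)))))) , inj₂ refl)
    where
    i≡1+n : toℕ i ≡ suc n
    i≡1+n = ℕ.≤-antisym (toℕ≤pred[n] i) (ℕ.≰⇒> λ i≤n → lo≰0 (ℕ.≤-reflexive (ℕ.m≤n⇒m∸n≡0 i≤n)))
  -- The lower end is at most `1`, hence never above `suc j`.
  window (suc i) (suc j) | inj₁ _ | no lo≰j = contradiction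
    (ℕ.≤-trans (ℕ.∸-monoˡ-≤ n (toℕ≤pred[n] i))
      (ℕ.≤-trans (ℕ.≤-reflexive (ℕ.m+n∸n≡m 1 n)) (s≤s z≤n)))
    lo≰j

  count : sum (suc ∘ w) ≡ (3 + n) C 2
  count = trans (cong suc (begin
    -- The cap `n` matters only in the last summand, which is `suc n` instead of `2 + n`.
    sum {2 + n} (λ i → suc (toℕ i ⊓ n))          ≡⟨ sum-init-last {suc n} (λ i → suc (toℕ i ⊓ n)) ⟩
    sum {1 + n} (λ i → suc (toℕ (inject₁ i) ⊓ n)) + suc (toℕ (fromℕ (suc n)) ⊓ n)
      ≡⟨ cong₂ _+_ (sum-cong-≗ {suc n} λ i → cong suc
           (trans (cong (_⊓ n) (toℕ-inject₁ i)) (ℕ.m≤n⇒m⊓n≡m (toℕ≤pred[n] i))))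
         (cong suc (trans (cong (_⊓ n) (toℕ-fromℕ (suc n))) (ℕ.m≥n⇒m⊓n≡n (ℕ.n≤1+n n)))) ⟩
    sum {1 + n} (suc ∘ toℕ) + suc n              ≡⟨ cong (_+ suc n) (triangle (suc n)) ⟩
    (2 + n) C 2 + suc n                          ≡⟨ ℕ.+-comm ((2 + n) C 2) (suc n) ⟩
    suc n + (2 + n) C 2                          ∎))
    (sym ([1+n]C2≡n+nC2 (2 + n)))
    where open ≡-Reasoning

-- Lower bound for matchings

-- Otherwise a second removal of `x` would lower the cardinality again, but removal is idempotent.
x∉p-x : ∀ (p : Subset n) {x} → ¬ x ∈ p - x
x∉p-x p {x} x∈ = ℕ.<-irrefl (cong ∣_∣ (p─q─q≡p─q p ⁅ x ⁆)) (x∈p⇒∣p-x∣<∣p∣ x∈)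

remove : (Fin k → Fin n) → Subset n → Subset n
remove {zero}  g p = p
remove {suc k} g p = remove (g ∘ suc) (p - g zero)

∈-remove⁺ : (g : Fin k → Fin n) (p : Subset n) → ∀ {x} → x ∈ p → (∀ i → x ≢ g i) → x ∈ remove g p
∈-remove⁺ {zero}  g p x∈p x∉g = x∈p
∈-remove⁺ {suc k} g p x∈p x∉g = ∈-remove⁺ (g ∘ suc) (p - g zero) (x∈p∧x≢y⇒x∈p-y x∈p (x∉g zero)) (x∉g ∘ suc)

∈-remove⁻ : (g : Fin k → Fin n) (p : Subset n) → ∀ {x} → x ∈ remove g p → x ∈ p × (∀ i → x ≢ g i)
∈-remove⁻ {zero}  g p x∈ = x∈ , λ ()
∈-remove⁻ {suc k} g p {x} x∈ with ∈-remove⁻ (g ∘ suc) (p - g zero) x∈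
... | x∈p-g₀ , x∉ = p─q⊆p p _ x∈p-g₀ , λ
  { zero    x≡ → x∉p-x p (subst (_∈ p - g zero) x≡ x∈p-g₀)
  ; (suc i) → x∉ i }

-- Injectivity keeps each later `g i` in the set until its turn, so every removal costs one element.
∣remove∣ : (g : Fin k → Fin n) (p : Subset n) → Injective _≡_ _≡_ g → (∀ i → g i ∈ p) →
           k + ∣ remove g p ∣ ≤ ∣ p ∣
∣remove∣ {zero}  g p inj g∈p = ℕ.≤-refl
∣remove∣ {suc k} g p inj g∈p = ℕ.≤-trans
  (s≤s (∣remove∣ (g ∘ suc) (p - g zero) (suc-injective ∘ inj)
    λ i → x∈p∧x≢y⇒x∈p-y (g∈p (suc i)) (0≢1+n ∘ sym ∘ inj)))
  (x∈p⇒∣p-x∣<∣p∣ (g∈p zero))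

module _ (G : Multigraph m) where
  open Multigraph G

  -- Relativizing to an edge set `S` lets the induction delete edges while `G` stays fixed.
  ProperOn : Subset m → Coloring G → Set
  ProperOn S c = ∀ {e f v} → e ∈ S → f ∈ S → e ≢ f → v isEndpointOf e → v isEndpointOf f → c e ≢ c f

  RainbowMatching : ℕ → Subset m → Coloring G → Set
  RainbowMatching k S c = Σ (Fin k → Edge) λ f → (∀ i → f i ∈ S) ×
    (∀ {i j v} → i ≢ j → v isEndpointOf f i → v isEndpointOf f j → ⊥) × Injective _≡_ _≡_ (c ∘ f)

  restrict : ∀ {S} c (ι : Fin a → Fin b) → Injective _≡_ _≡_ ι → RainbowMatching b S c → RainbowMatching a S c
  restrict c ι ι-inj (f , f∈S , disjoint , inj) =
    f ∘ ι , f∈S ∘ ι , (λ i≢j → disjoint (i≢j ∘ ι-inj)) , ι-inj ∘ inj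

  module Recolor (g : Fin k → Edge) (disjoint : ∀ {i j v} → i ≢ j → v isEndpointOf g i → v isEndpointOf g j → ⊥)
                 (S : Subset m) (c : Coloring G) where

    hit? : ∀ e → Dec (∃ λ i → g i ≡ e)
    hit? e = any? λ i → g i ≟ e

    -- The shift by `suc` frees color `0` for the matching `g`.
    recolor : Coloring G
    recolor e = if does (hit? e) then 0 else suc (c e)

    recolor-hit : ∀ {e} → (∃ λ i → g i ≡ e) → recolor e ≡ 0
    recolor-hit {e} h = cong (if_then 0 else suc (c e)) (dec-true (hit? e) h)

    recolor-miss : ∀ {e} → ¬ (∃ λ i → g i ≡ e) → recolor e ≡ suc (c e)
    recolor-miss {e} ¬h = cong (if_then 0 else suc (c e)) (dec-false (hit? e) ¬h)

    kept : ∀ {e} → e ∈ S → ¬ (∃ λ i → g i ≡ e) → e ∈ remove g S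
    kept e∈S ¬h = ∈-remove⁺ g S e∈S λ i e≡ → ¬h (i , sym e≡)

    -- Two edges of color `0` both belong to `g`, so they share no endpoint.
    recolor-proper : ProperOn (remove g S) c → ProperOn S recolor
    recolor-proper proper {e} {f} e∈S f∈S e≢f v∈e v∈f eq with hit? e | hit? f
    ... | yes (i , refl) | yes (j , refl) = disjoint (e≢f ∘ cong g) v∈e v∈f
    ... | yes _          | no _           = contradiction eq λ ()
    ... | no _           | yes _          = contradiction eq λ ()
    ... | no ¬e          | no ¬f          =
      proper (kept e∈S ¬e) (kept f∈S ¬f) e≢f v∈e v∈f (ℕ.suc-injective eq)

    missing : ∀ {a} ((f , _) : RainbowMatching a S recolor) → (∀ i → ¬ (∃ λ x → g x ≡ f i)) →
              RainbowMatching a (remove g S) c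
    missing (f , f∈S , f-disjoint , inj) miss = f , (λ i → kept (f∈S i) (miss i)) , f-disjoint ,
      λ {i} {j} eq → inj (trans (recolor-miss (miss i)) (trans (cong suc eq) (sym (recolor-miss (miss j)))))

    -- At most one edge has color `0`. That edge is dropped; if there is none, the first edge is
    -- dropped to get the size right.
    recolor-rainbow : ∀ {a} → RainbowMatching (suc a) S recolor → RainbowMatching a (remove g S) c
    recolor-rainbow M@(f , _ , _ , inj) with any? (λ i → hit? (f i))
    ... | no  none    = missing (restrict recolor suc suc-injective M) λ i h → none (suc i , h)
    ... | yes (i , h) = missing (restrict recolor (punchIn i) (punchIn-injective i _ _) M) λ j h′ →
      punchInᵢ≢i i j (inj (trans (recolor-hit h′) (sym (recolor-hit h))))

  matching-bound : ∀ k S → (∀ c → ProperOn S c → RainbowMatching k S c) → suc k C 2 ≤ ∣ S ∣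
  -- `1 C 2` computes to `0`.
  matching-bound zero    S forces = z≤n
  matching-bound (suc k) S forces
    -- Under `toℕ` all edges have different colors, so it is proper; the matching `g` it yields is
    -- the one to delete.
    with forces toℕ (λ _ _ e≢f _ _ p → e≢f (toℕ-injective p))
  ... | g , g∈S , disjoint , inj = ℕ.≤-trans
    (ℕ.≤-reflexive ([1+n]C2≡n+nC2 (suc k)))
    (ℕ.≤-trans
      (ℕ.+-monoʳ-≤ (suc k) (matching-bound k (remove g S) λ c proper →
        let open Recolor g disjoint S c in recolor-rainbow (forces recolor (recolor-proper proper))))
      (∣remove∣ g S (inj ∘ cong toℕ) g∈S))

-- A common endpoint of two image edges would, as `φ` is injective, come from one vertex of the
-- matching, and `edge` reads off the only edge there.
embedding⇒rainbowMatching : (G : Multigraph m) (c : Coloring G) →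
                            RainbowEmbedding (matching k) G c → RainbowMatching G k ⊤ c
embedding⇒rainbowMatching {k = k} G c (φ , φ-inj , g , joins , inj) = g , (λ _ → ∈⊤) , disjoint , inj
  where
  open Multigraph G

  end : Fin k → Fin 2 → Fin (k + k)
  end i zero       = i ↑ˡ k
  end i (suc zero) = k ↑ʳ i

  edge : Fin (k + k) → Fin k
  edge = [ id , id ]′ ∘ splitAt k

  edge-end : ∀ i b → edge (end i b) ≡ i
  edge-end i zero       = cong [ id , id ]′ (splitAt-↑ˡ k i k)
  edge-end i (suc zero) = cong [ id , id ]′ (splitAt-↑ʳ k k i)

  endpoint : ∀ {v} i → v isEndpointOf g i → ∃ λ b → φ (end i b) ≡ v
  endpoint i v∈ with joins i | v∈
  ... | inj₁ (p , q) | inj₁ refl = zero , sym p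
  ... | inj₁ (p , q) | inj₂ refl = suc zero , sym q
  ... | inj₂ (p , q) | inj₁ refl = suc zero , sym p
  ... | inj₂ (p , q) | inj₂ refl = zero , sym q

  disjoint : ∀ {i j v} → i ≢ j → v isEndpointOf g i → v isEndpointOf g j → ⊥
  disjoint {i} {j} i≢j v∈i v∈j with endpoint i v∈i | endpoint j v∈j
  ... | b , p | b′ , q = i≢j (trans (sym (edge-end i b))
    (trans (cong edge (φ-inj (trans p (sym q)))) (edge-end j b′)))

forced-matching⇒≥ : ForcedWith (matching k) m → suc k C 2 ≤ m
forced-matching⇒≥ {k} {m} (G , forces) = subst (suc k C 2 ≤_) (∣⊤∣≡n m)
  (matching-bound G k ⊤ λ c proper → embedding⇒rainbowMatching G c
    (copy⇒embedding (matching k) G c (forces c (proper ∈⊤ ∈⊤))))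

theorem7 : ((k : ℕ) (H : SimpleGraph k) → AR*ₛ[ H ]≤ ((k + 1) C 2))
    × ((k : ℕ) → 1 ≤ k → AR*ₛ[ path k ]≤ ((k C 2) + 1))
    × ((k : ℕ) (3≤k : 3 ≤ k) → AR*ₛ[ cycle k 3≤k ]≤ (k C 2))
    × ((k : ℕ) → 1 ≤ k → AR*ₛ[ matching k ]≡ ((k + 1) C 2))
theorem7 =
  (λ k H → forcedWith⇒AR≤ H (subst (λ n → ForcedWith H (n C 2)) (ℕ.+-comm 1 k) (forced-triangle H))) ,
  (λ { (suc n) _ → forcedWith⇒AR≤ (path (suc n))
         (subst (ForcedWith (path (suc n))) (ℕ.+-comm 1 (suc n C 2)) (forced-path n)) }) ,
  (λ k 3≤k → forcedWith⇒AR≤ (cycle k 3≤k) (forced-cycle k 3≤k)) ,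
  -- The minimum is explicit here, so the two bounds give it without a search.
  (λ k _ → subst (λ n → AR*ₛ[ matching k ]≡ (n C 2)) (ℕ.+-comm 1 k)
     (forced-triangle (matching k) , λ _ → forced-matching⇒≥))
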